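{- Let $\mathcal{H}$ be a collection of at least $9$ distinct sets. Then at least one of the matrices $S^3$, $\bar S^3$, $M^3$ can be found in $\mathcal{H}$. Hence $S(2,2)=8$.
   Context: A 0-1 matrix $N$ with $a$ rows and $b$ columns can be found in a collection of sets $\mathcal{H}$ if there are distinct sets $H_1,\dots,H_a\in\mathcal{H}$ and distinct elements $e_1,\dots,e_b\in\bigcup_{H\in\mathcal{H}}H$ such that $N_{\alpha,\beta}=1$ if and only if $e_\beta\in H_\alpha$. For an integer $n\ge 1$, the following matrices have $n+1$ rows and $n$ columns with entries in $\{0,1\}$: the $n$-singleton matrix $S^n$, with $S^n_{i,j}=1$ iff $i=j+1$; the $n$-cosingleton matrix $\bar S^n$, with $\bar S^n_{i,j}=0$ iff $i=j$; the $n$-monotone matrix $M^n$, with $M^n_{i,j}=1$ iff $i\ge j+1$. For non-negative integers $k,l$, $S(k,l)$ is the smallest non-negative integer $S$ such that for every collection of distinct sets $\mathcal{H}$ with $|\mathcal{H}|>S$, at least one of $S^{k+1}$, $\bar S^{l+1}$, $M^{\min(k+1,l+1)}$ can be found in $\mathcal{H}$ (such an integer exists). -}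

module Defs where

open import Data.Bool.Base using (Bool; true; not)
open import Data.Fin.Base using (Fin; suc; inject₁)
open import Data.Fin.Properties using (_≟_; _≤?_)
open import Data.Nat.Base using (ℕ; suc; _≤_; _⊓_)
open import Data.Product.Base using (Σ-syntax; ∃; _×_; proj₁)
open import Data.Sum.Base using (_⊎_)
open import Function.Bundles using (_⇔_)
open import Function.Definitions using (Injective)
open import Level using (Level) renaming (suc to lsuc)
open import Relation.Binary.PropositionalEquality.Core using (_≡_)
open import Relation.Nullary.Decidable.Core using (does)
open import Relation.Unary using (Pred; _∈_; _≐_; ⋃)

private
  variable
    a b : ℕ
    ℓ : Level

-- 0-1 matrices with a rows and b columns; true stands for 1, false for 0.
Matrix : ℕ → ℕ → Set
Matrix a b = Fin a → Fin b → Bool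

-- Rows and columns are numbered from 0, so the row with 1-based number j + 1
-- is suc j, and the row with the same number as column j is inject₁ j.
singleton : ∀ n → Matrix (suc n) n
singleton n i j = does (i ≟ suc j)

cosingleton : ∀ n → Matrix (suc n) n
cosingleton n i j = not (does (i ≟ inject₁ j))

monotone : ∀ n → Matrix (suc n) n
monotone n i j = does (suc j ≤? i)

-- Sets are predicates, and two sets are equal when they have the same
-- elements (_≐_).  Collections and their ground sets are arbitrary, possibly
-- infinite.  A collection need not be closed under _≐_, but its members are
-- always counted up to _≐_.
Collection : Set ℓ → Set (lsuc ℓ)
Collection {ℓ} A = Pred (Pred A ℓ) ℓ

module _ {A : Set ℓ} where

  -- ∣ H ∣ ≥ n: there are n distinct sets in H.
  AtLeast : ℕ → Collection A → Set (lsuc ℓ)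
  AtLeast n H = Σ[ X ∈ (Fin n → Pred A ℓ) ]
    Injective _≡_ _≐_ X × (∀ i → X i ∈ H)

  FoundIn : Matrix a b → Collection A → Set (lsuc ℓ)
  FoundIn {a} {b} N H =
    Σ[ X ∈ (Fin a → Pred A ℓ) ] Σ[ e ∈ (Fin b → A) ]
      Injective _≡_ _≐_ X × (∀ α → X α ∈ H) ×
      Injective _≡_ _≡_ e × (∀ β → e β ∈ ⋃ (∃ H) proj₁) ×
      (∀ α β → N α β ≡ true ⇔ e β ∈ X α)

-- Every collection of more than s sets contains one of the three matrices.
Forces : ∀ ℓ (k l s : ℕ) → Set (lsuc ℓ)
Forces ℓ k l s = {A : Set ℓ} (H : Collection A) → AtLeast (suc s) H →
  FoundIn (singleton (suc k)) H ⊎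
  FoundIn (cosingleton (suc l)) H ⊎
  FoundIn (monotone (suc k ⊓ suc l)) H

-- S(k, l) = s.
IsS : ∀ ℓ (k l s : ℕ) → Set (lsuc ℓ)
IsS ℓ k l s = Forces ℓ k l s × (∀ t → Forces ℓ k l t → s ≤ t)

{-# OPTIONS --safe #-}

-- Start from nine sets, all in one class, and as long as some class holds two
-- sets, split all classes by an element that separates those two.  A class is
-- described by the common 0-1 word of its sets on the elements chosen so far
-- and by its size, so each splitting step has finitely many outcomes.  An
-- exhaustive search shows that every sequence of outcomes produces three
-- elements on which the traces of the sets contain a forbidden matrix.
-- Eight sets on four points show that nine is optimal.
module Submission where

open import Defs
open import Axiom.ExcludedMiddle using (ExcludedMiddle)
open import Data.Bool.Base using (Bool; true; false; T; _∧_; _∨_; if_then_else_)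
open import Data.Bool.Properties using (T-∧; T-∨; T-≡; ⇔→≡) renaming (_≟_ to _≟ᵇ_)
open import Data.Empty using (⊥-elim)
open import Data.Fin using (#_)
open import Data.Fin.Base using (Fin; zero; suc; inject≤)
open import Data.Fin.Properties using (all?; any?; inject≤-injective) renaming (_≟_ to _≟ᶠ_)
open import Data.List.Base using (List; []; _∷_; _++_; map; filter; length)
import Data.List.Base as List
open import Data.List.Properties using (length-tabulate)
open import Data.List.Relation.Binary.Pointwise as ListPointwise using ([]; _∷_)
open import Data.List.Relation.Unary.All as All using (All; []; _∷_)
import Data.List.Relation.Unary.All.Properties as All
open import Data.List.Relation.Unary.AllPairs using (AllPairs; []; _∷_)
import Data.List.Relation.Unary.AllPairs.Properties as AllPairs
open import Data.Nat.Base using (ℕ; zero; suc; _+_; _≤_; _≤ᵇ_; _<ᵇ_)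
open import Data.Nat.Properties using (+-comm; +-identityʳ; +-suc; suc-injective; ≮⇒≥)
open import Data.Product.Base using (∃; ∃₂; Σ-syntax; _×_; _,_; proj₁; proj₂)
open import Data.Sum.Base using (_⊎_; inj₁; inj₂; [_,_])
open import Data.Vec.Base using (Vec; []; _∷_; lookup; tabulate)
import Data.Vec.Base as Vec
open import Data.Vec.Properties using (lookup∘tabulate)
open import Data.Vec.Relation.Unary.All as VecAll using ([]; _∷_)
import Data.Vec.Relation.Unary.All.Properties as VecAll
open import Data.Vec.Relation.Binary.Pointwise.Inductive as VecPointwise using ([]; _∷_)
open import Function.Base using (_∘_; const)
open import Function.Bundles using (_⇔_; mk⇔; Equivalence)
open import Function.Definitions using (Injective)
open import Level using (Level; Lift; lift; lower) renaming (suc to lsuc)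
open import Relation.Binary.PropositionalEquality
  using (_≡_; refl; sym; trans; cong; subst)
open import Relation.Nullary using (Dec; yes; no; ¬_; contradiction)
open import Relation.Nullary.Decidable using (_×-dec_; _→-dec_; ¬?; from-yes)
open import Relation.Unary using (Pred; _∈_; _∉_; _⊆_; _≐_; Decidable)
open import Relation.Unary.Properties using (∁?)

open Equivalence using (to; from)

private
  variable
    ℓ : Level
    B : Set ℓ
    a b n : ℕ

-- Exhaustive search over words and class sizes

Word : Set
Word = List Bool

State : Set
State = List (Word × ℕ)

-- A field is true if its word has been seen as the trace of a set on the
-- three elements that the table belongs to.
data Table : Set where
  table : (t₀₀₀ t₀₀₁ t₀₁₀ t₀₁₁ t₁₀₀ t₁₀₁ t₁₁₀ t₁₁₁ : Bool) → Table

empty : Table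
empty = table false false false false false false false false

insert : Bool → Bool → Bool → Table → Table
insert false false false (table _ b c d e f g h) = table true b c d e f g h
insert false false true  (table a _ c d e f g h) = table a true c d e f g h
insert false true  false (table a b _ d e f g h) = table a b true d e f g h
insert false true  true  (table a b c _ e f g h) = table a b c true e f g h
insert true  false false (table a b c d _ f g h) = table a b c d true f g h
insert true  false true  (table a b c d e _ g h) = table a b c d e true g h
insert true  true  false (table a b c d e f _ h) = table a b c d e f true h
insert true  true  true  (table a b c d e f g _) = table a b c d e f g true

-- Up to the order of the three elements, `singleton 3` consists of the words with at most one
-- `true`, `cosingleton 3` of those with at least two, and `monotone 3` of one of the six maximal
-- chains from 000 to 111.
forbidden : Table → Bool
forbidden (table t₀₀₀ t₀₀₁ t₀₁₀ t₀₁₁ t₁₀₀ t₁₀₁ t₁₁₀ t₁₁₁) =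
  (t₀₀₀ ∧ (t₀₀₁ ∧ t₀₁₀ ∧ t₁₀₀ ∨
           t₁₁₁ ∧ (t₀₀₁ ∧ (t₀₁₁ ∨ t₁₀₁) ∨
                   t₀₁₀ ∧ (t₀₁₁ ∨ t₁₁₀) ∨
                   t₁₀₀ ∧ (t₁₀₁ ∨ t₁₁₀)))) ∨
  (t₁₁₁ ∧ t₀₁₁ ∧ t₁₀₁ ∧ t₁₁₀)

pairs : List B → List (B × B)
pairs []       = []
pairs (x ∷ xs) = map (x ,_) xs ++ pairs xs

-- The search is in continuation-passing style, so that a branch is abandoned
-- as soon as a forbidden matrix shows up.  The table is an argument here so that
-- the evaluator shares it between the test and the continuation.
unless-forbidden : Table → (Table → Bool) → Bool
unless-forbidden t k = forbidden t ∨ k t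

record-traces : Bool → List (Bool × Bool) → List Table → (List Table → Bool) → Bool
record-traces p []             ts       k = k ts
-- A default value: the soundness proof only meets lists of equal length.
record-traces p (_ ∷ _)        []       k = k []
record-traces p ((q , r) ∷ qs) (t ∷ ts) k =
  unless-forbidden (insert p q r t) λ t → record-traces p qs ts λ ts → k (t ∷ ts)

-- Singletons go last, so that the head of a state is the smallest class that
-- can still be split.
precedes : ℕ → ℕ → Bool
precedes m n = (n <ᵇ 2) ∨ ((1 <ᵇ m) ∧ (m ≤ᵇ n))

add : Word → ℕ → State → State
add w m []            = (w , m) ∷ []
add w m ((v , n) ∷ s) =
  if precedes m n then (w , m) ∷ (v , n) ∷ s else (v , n) ∷ add w m s

half : Bool → Word → List (Bool × Bool) → ℕ → State → List Table →
       (State → List Table → Bool) → Bool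
half p w qs zero      s ts k = k s ts
half p w qs n@(suc _) s ts k = record-traces p qs ts (k (add (p ∷ w) n s))

halves : Word → List (Bool × Bool) → State → List Table →
         (State → List Table → Bool) → ℕ → ℕ → Bool
halves w qs s ts k i j =
  half true w qs i s ts λ s ts → half false w qs j s ts k

-- The second argument accumulates, so `sums n 0 f` covers every way to distribute `n` sets over two
-- halves.
sums : ℕ → ℕ → (ℕ → ℕ → Bool) → Bool
sums zero    m f = f zero m
sums (suc n) m f = f (suc n) m ∧ sums n (suc m) f

split-all : State → State → List Table → (State → Bool) → Bool
split-all []            s ts k = k s
split-all ((w , n) ∷ p) s ts k =
  sums n 0 (halves w (pairs w) s ts λ s ts → split-all p s ts k)

-- Two sets of the head class are separated by the new element, so only its other `n` sets are
-- distributed freely. Tables restart empty because all classes are split and leave their traces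
-- anew; triples of older elements were tested when their last element was chosen. The default
-- `false` is safe, since only the answer `true` is used. Each round increases the number of
-- nonempty classes, so nine sets allow at most eight rounds.
unavoidable? : ℕ → State → Bool
unavoidable? (suc f) ((w , suc (suc n)) ∷ p) = sums n 0 λ i j →
  halves w (pairs w) [] (map (const empty) (pairs w))
    (λ s ts → split-all p s ts (unavoidable? f)) (suc i) (suc j)
unavoidable? _       _                       = false

-- After `k` rounds the first argument has dropped from `k + i` to `i` and the accumulator has grown
-- by `k`.
sums-sound : ∀ f k {i m} → T (sums (k + i) m f) → T (f i (k + m))
sums-sound f zero    {zero}  t = t
sums-sound f zero    {suc i} t = proj₁ (to T-∧ t)
sums-sound f (suc k) {i} {m} t =
  subst (T ∘ f i) (+-suc k m) (sums-sound f k (proj₂ (to (T-∧ {f (suc (k + i)) m}) t)))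

-- Matrices for which the two distinctness conditions in FoundIn and the
-- condition on the ground set hold automatically.
Reduced : Matrix a b → Set
Reduced N =
  (∀ i i′ → (∀ j → N i j ≡ N i′ j) → i ≡ i′) ×
  (∀ j j′ → (∀ i → N i j ≡ N i j′) → j ≡ j′) ×
  (∀ j → ∃ λ i → N i j ≡ true)

reduced? : (N : Matrix a b) → Dec (Reduced N)
reduced? N =
  (all? λ i → all? λ i′ → all? (λ j → N i j ≟ᵇ N i′ j) →-dec i ≟ᶠ i′) ×-dec
  (all? λ j → all? λ j′ → all? (λ i → N i j ≟ᵇ N i j′) →-dec j ≟ᶠ j′) ×-dec
  (all? λ j → any? λ i → N i j ≟ᵇ true)

-- Forbidden matrices from traces on three elements

module _ {A : Set ℓ} (H : Collection A) where

  Unavoidable : Set (lsuc ℓ)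
  Unavoidable = FoundIn (singleton 3) H ⊎ FoundIn (cosingleton 3) H ⊎ FoundIn (monotone 3) H

  Agrees : Pred A ℓ → A → Bool → Set ℓ
  Agrees X x p = p ≡ true ⇔ x ∈ X

  Seen : Vec A n → Vec Bool n → Set (lsuc ℓ)
  Seen e v = Σ[ X ∈ Pred A ℓ ] X ∈ H × VecPointwise.Pointwise (Agrees X) e v

  foundIn : (N : Matrix a b) → Reduced N → (e : Vec A b) →
            VecAll.All (Seen e) (tabulate (tabulate ∘ N)) → FoundIn N H
  foundIn N (rows , columns , nonzero) e traces =
    X , lookup e , X-injective , X∈H , e-injective , e∈⋃H , N⇔∈
    where
    seen : ∀ i → Seen e (tabulate (N i))
    seen = VecAll.tabulate⁻ traces
    X = proj₁ ∘ seen
    X∈H = proj₁ ∘ proj₂ ∘ seen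
    N⇔∈ : ∀ i j → N i j ≡ true ⇔ lookup e j ∈ X i
    N⇔∈ i j = subst (Agrees (X i) (lookup e j)) (lookup∘tabulate (N i) j)
                    (VecPointwise.lookup (proj₂ (proj₂ (seen i))) j)
    X-injective : Injective _≡_ _≐_ X
    X-injective {i} {i′} (X⊆X′ , X′⊆X) = rows i i′ λ j → ⇔→≡ (mk⇔
      (λ p → from (N⇔∈ i′ j) (X⊆X′ (to (N⇔∈ i j) p)))
      (λ p → from (N⇔∈ i j) (X′⊆X (to (N⇔∈ i′ j) p))))
    e-injective : Injective _≡_ _≡_ (lookup e)
    e-injective {j} {j′} eq = columns j j′ λ i → ⇔→≡ (mk⇔
      (λ p → from (N⇔∈ i j′) (subst (_∈ X i) eq (to (N⇔∈ i j) p)))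
      (λ p → from (N⇔∈ i j) (subst (_∈ X i) (sym eq) (to (N⇔∈ i j′) p))))
    e∈⋃H : ∀ j → ∃ λ (Y : ∃ H) → lookup e j ∈ proj₁ Y
    e∈⋃H j = let i , p = nonzero j in (X i , X∈H i) , to (N⇔∈ i j) p

  -- Reordering the coordinates lets a chain in any of the six orders be read as `monotone 3`.
  select : (π : Vec (Fin n) b) {e : Vec A n} {v : Vec Bool n} →
           Seen e v → Seen (Vec.map (lookup e) π) (Vec.map (lookup v) π)
  select π {e} {v} (X , X∈H , agree) = X , X∈H , go π
    where
    go : ∀ {m} (π : Vec (Fin _) m) →
         VecPointwise.Pointwise (Agrees X) (Vec.map (lookup e) π) (Vec.map (lookup v) π)
    go []      = []
    go (i ∷ π) = VecPointwise.lookup agree i ∷ go π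

  -- Only `true` fields make a claim, so a partially filled table is sound as well.
  Sound : A → A → A → Table → Set (lsuc ℓ)
  Sound x y z (table t₀₀₀ t₀₀₁ t₀₁₀ t₀₁₁ t₁₀₀ t₁₀₁ t₁₁₀ t₁₁₁) =
    seen false false false t₀₀₀ × seen false false true t₀₀₁ ×
    seen false true  false t₀₁₀ × seen false true  true t₀₁₁ ×
    seen true  false false t₁₀₀ × seen true  false true t₁₀₁ ×
    seen true  true  false t₁₁₀ × seen true  true  true t₁₁₁
    where
    seen : (p q r t : Bool) → Set _
    seen p q r t = T t → Seen (x ∷ y ∷ z ∷ []) (p ∷ q ∷ r ∷ [])

  empty-sound : ∀ {x y z} → Sound x y z empty
  empty-sound = (λ ()) , (λ ()) , (λ ()) , (λ ()) , (λ ()) , (λ ()) , (λ ()) , (λ ())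

  insert-sound : ∀ {x y z} p q r t → Seen (x ∷ y ∷ z ∷ []) (p ∷ q ∷ r ∷ []) →
                 Sound x y z t → Sound x y z (insert p q r t)
  insert-sound false false false (table _ _ _ _ _ _ _ _) s (_ , u) = const s , u
  insert-sound false false true  (table _ _ _ _ _ _ _ _) s (a , _ , u) = a , const s , u
  insert-sound false true  false (table _ _ _ _ _ _ _ _) s (a , b , _ , u) = a , b , const s , u
  insert-sound false true  true  (table _ _ _ _ _ _ _ _) s (a , b , c , _ , u) =
    a , b , c , const s , u
  insert-sound true  false false (table _ _ _ _ _ _ _ _) s (a , b , c , d , _ , u) =
    a , b , c , d , const s , u
  insert-sound true  false true  (table _ _ _ _ _ _ _ _) s (a , b , c , d , e , _ , u) =
    a , b , c , d , e , const s , u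
  insert-sound true  true  false (table _ _ _ _ _ _ _ _) s (a , b , c , d , e , f , _ , u) =
    a , b , c , d , e , f , const s , u
  insert-sound true  true  true  (table _ _ _ _ _ _ _ _) s (a , b , c , d , e , f , g , _) =
    a , b , c , d , e , f , g , const s

  forbidden-sound : ∀ {x y z} t → Sound x y z t → T (forbidden t) → Unavoidable
  forbidden-sound {x} {y} {z} (table t₀₀₀ t₀₀₁ t₀₁₀ t₀₁₁ t₁₀₀ t₁₀₁ t₁₁₀ t₁₁₁)
    (s₀₀₀ , s₀₀₁ , s₀₁₀ , s₀₁₁ , s₁₀₀ , s₁₀₁ , s₁₁₀ , s₁₁₁) bad
    with to T-∨ bad
  ... | inj₂ bad =
    let b₁₁₁ , bad = to T-∧ bad ; b₀₁₁ , bad = to T-∧ bad ; b₁₀₁ , b₁₁₀ = to T-∧ bad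
    in inj₂ (inj₁ (foundIn _ (from-yes (reduced? (cosingleton 3))) (x ∷ y ∷ z ∷ [])
         (s₀₁₁ b₀₁₁ ∷ s₁₀₁ b₁₀₁ ∷ s₁₁₀ b₁₁₀ ∷ s₁₁₁ b₁₁₁ ∷ [])))
  ... | inj₁ bad with to T-∧ bad
  ... | b₀₀₀ , bad with to T-∨ bad
  ... | inj₁ bad =
    let b₀₀₁ , bad = to T-∧ bad ; b₀₁₀ , b₁₀₀ = to T-∧ bad
    in inj₁ (foundIn _ (from-yes (reduced? (singleton 3))) (x ∷ y ∷ z ∷ [])
         (s₀₀₀ b₀₀₀ ∷ s₁₀₀ b₁₀₀ ∷ s₀₁₀ b₀₁₀ ∷ s₀₀₁ b₀₀₁ ∷ []))
  ... | inj₂ bad with to (T-∧ {t₁₁₁}) bad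
  ... | b₁₁₁ , bad = chains bad
    where
    chain : ∀ {u v} → Seen (x ∷ y ∷ z ∷ []) u → Seen (x ∷ y ∷ z ∷ []) v →
            (π : Vec (Fin 3) 3) →
            Vec.map (λ w → Vec.map (lookup w) π)
              ((false ∷ false ∷ false ∷ []) ∷ u ∷ v ∷ (true ∷ true ∷ true ∷ []) ∷ [])
              ≡ tabulate (tabulate ∘ monotone 3) →
            Unavoidable
    chain s s′ π eq =
      inj₂ (inj₂ (foundIn _ (from-yes (reduced? (monotone 3))) _
        (subst (VecAll.All (Seen _)) eq (VecAll.gmap (λ {v} → select π {x ∷ y ∷ z ∷ []} {v})
          (s₀₀₀ b₀₀₀ ∷ s ∷ s′ ∷ s₁₁₁ b₁₁₁ ∷ [])))))

    chains : T (t₀₀₁ ∧ (t₀₁₁ ∨ t₁₀₁) ∨ t₀₁₀ ∧ (t₀₁₁ ∨ t₁₁₀) ∨ t₁₀₀ ∧ (t₁₀₁ ∨ t₁₁₀)) →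
             Unavoidable
    chains bad with to (T-∨ {t₀₀₁ ∧ (t₀₁₁ ∨ t₁₀₁)}) bad
    ... | inj₁ bad =
      let b₀₀₁ , bad = to T-∧ bad in
      -- Here and below, the permutation lists the elements in the order in which the chain acquires
      -- them.
      [ (λ b₀₁₁ → chain (s₀₀₁ b₀₀₁) (s₀₁₁ b₀₁₁) (# 2 ∷ # 1 ∷ # 0 ∷ []) refl)
      , (λ b₁₀₁ → chain (s₀₀₁ b₀₀₁) (s₁₀₁ b₁₀₁) (# 2 ∷ # 0 ∷ # 1 ∷ []) refl)
      ] (to T-∨ bad)
    ... | inj₂ bad with to (T-∨ {t₀₁₀ ∧ (t₀₁₁ ∨ t₁₁₀)}) bad
    ... | inj₁ bad =
      let b₀₁₀ , bad = to T-∧ bad in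
      [ (λ b₀₁₁ → chain (s₀₁₀ b₀₁₀) (s₀₁₁ b₀₁₁) (# 1 ∷ # 2 ∷ # 0 ∷ []) refl)
      , (λ b₁₁₀ → chain (s₀₁₀ b₀₁₀) (s₁₁₀ b₁₁₀) (# 1 ∷ # 0 ∷ # 2 ∷ []) refl)
      ] (to T-∨ bad)
    ... | inj₂ bad =
      let b₁₀₀ , bad = to T-∧ bad in
      [ (λ b₁₀₁ → chain (s₁₀₀ b₁₀₀) (s₁₀₁ b₁₀₁) (# 0 ∷ # 2 ∷ # 1 ∷ []) refl)
      , (λ b₁₁₀ → chain (s₁₀₀ b₁₀₀) (s₁₁₀ b₁₁₀) (# 0 ∷ # 1 ∷ # 2 ∷ []) refl)
      ] (to T-∨ bad)

  -- Soundness of recording and of halving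

  Tabulated : A → List (A × A) → List Table → Set (lsuc ℓ)
  Tabulated x = ListPointwise.Pointwise λ (y , z) → Sound x y z

  Traces : Pred A ℓ → List A → Word → Set ℓ
  Traces X = ListPointwise.Pointwise (Agrees X)

  PairTraces : Pred A ℓ → List (A × A) → List (Bool × Bool) → Set ℓ
  PairTraces X = ListPointwise.Pointwise λ (y , z) (q , r) → Agrees X y q × Agrees X z r

  pairs⁺ : ∀ {X e w} → Traces X e w → PairTraces X (pairs e) (pairs w)
  pairs⁺ []       = []
  pairs⁺ (p ∷ ps) =
    ListPointwise.++⁺ (ListPointwise.map⁺ _ _ (ListPointwise.map (p ,_) ps)) (pairs⁺ ps)

  empty-tabulated : ∀ {X x es qs} → PairTraces X es qs → Tabulated x es (map (const empty) qs)
  empty-tabulated []       = []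
  empty-tabulated (_ ∷ ps) = empty-sound ∷ empty-tabulated ps

  -- The proof follows the continuation-passing style of the search: success comes either from a
  -- forbidden table or from `k`, and `c` handles the latter for whichever tables have been reached.
  record-traces-sound : ∀ {X x p es qs ts} k → X ∈ H → Agrees X x p → PairTraces X es qs →
    Tabulated x es ts → T (record-traces p qs ts k) →
    (∀ {ts} → Tabulated x es ts → T (k ts) → Unavoidable) → Unavoidable
  record-traces-sound k X∈H p [] [] ok c = c [] ok
  record-traces-sound {X} {x} {p = b} {ts = t ∷ _} k X∈H p
    (_∷_ {x = y , z} {y = q , r} (p′ , p″) ps) (s ∷ ss) ok c =
    [ forbidden-sound (insert b q r t) s′
    , (λ ok → record-traces-sound _ X∈H p ps ss ok λ ss′ → c (s′ ∷ ss′))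
    ] (to T-∨ ok)
    where
    s′ : Sound x y z (insert b q r t)
    s′ = insert-sound b q r t (X , X∈H , p ∷ p′ ∷ p″ ∷ []) s

  -- The listed sets need not be all the members of `H` with trace `w`: the search relies only on
  -- the existence of `n` distinct ones.
  record Class (e : List A) (w : Word) (n : ℕ) : Set (lsuc ℓ) where
    constructor class
    field
      sets     : List (Pred A ℓ)
      distinct : AllPairs (λ X Y → ¬ X ≐ Y) sets
      members  : All (λ X → X ∈ H × Traces X e w) sets
      size     : length sets ≡ n

  Realised : List A → State → Set (lsuc ℓ)
  Realised e = All λ (w , n) → Class e w n

  member : ∀ {e w n} → Class e w (suc n) → Σ[ X ∈ Pred A ℓ ] X ∈ H × Traces X e w
  member (class (X ∷ _) _ (m ∷ _) _) = X , m

  add-realised : ∀ {e w n s} → Class e w n → Realised e s → Realised e (add w n s)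
  add-realised c [] = c ∷ []
  add-realised {n = m} c (_∷_ {_ , n} d ds) with precedes m n
  ... | true  = c ∷ d ∷ ds
  ... | false = d ∷ add-realised c ds

  -- All sets of a class have the same word, so a single member certifies every table entry that the
  -- word adds.
  half-sound : ∀ {x e p w s ts} n k → Class (x ∷ e) (p ∷ w) n → Realised (x ∷ e) s →
    Tabulated x (pairs e) ts → T (half p w (pairs w) n s ts k) →
    (∀ {s ts} → Realised (x ∷ e) s → Tabulated x (pairs e) ts → T (k s ts) → Unavoidable) →
    Unavoidable
  half-sound zero    k d ds ss ok c = c ds ss ok
  half-sound (suc n) k d ds ss ok c with member d
  ... | X , X∈H , p ∷ ps = record-traces-sound _ X∈H p (pairs⁺ ps) ss ok (c (add-realised d ds))

  halves-sound : ∀ {x e w s ts} i j k →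
    Class (x ∷ e) (true ∷ w) i → Class (x ∷ e) (false ∷ w) j → Realised (x ∷ e) s →
    Tabulated x (pairs e) ts → T (halves w (pairs w) s ts k i j) →
    (∀ {s ts} → Realised (x ∷ e) s → Tabulated x (pairs e) ts → T (k s ts) → Unavoidable) →
    Unavoidable
  halves-sound i j k d d′ ds ss ok c =
    half-sound i _ d ds ss ok λ ds ss ok → half-sound j k d′ ds ss ok c

  -- Splitting classes by an element

  module _ (em : ExcludedMiddle ℓ) where

    _∋?_ : ∀ (x : A) → Decidable (λ (X : Pred A ℓ) → x ∈ X)
    x ∋? X = em

    agrees-true : ∀ X {x} → x ∈ X → Agrees X x true
    agrees-true X x∈X = mk⇔ (const x∈X) (const refl)

    agrees-false : ∀ X {x} → x ∉ X → Agrees X x false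
    agrees-false X x∉X = mk⇔ (λ ()) (λ x∈X → contradiction x∈X x∉X)

    separate : ∀ {X Y : Pred A ℓ} → ¬ X ≐ Y → ∃ λ x → (x ∈ X × x ∉ Y) ⊎ (x ∈ Y × x ∉ X)
    separate {X} {Y} X≠Y with em {∃ λ x → x ∈ X × x ∉ Y} | em {∃ λ x → x ∈ Y × x ∉ X}
    ... | yes (x , p) | _           = x , inj₁ p
    ... | no _        | yes (x , p) = x , inj₂ p
    ... | no X⊆Y      | no Y⊆X      = ⊥-elim (X≠Y (⊆ X⊆Y , ⊆ Y⊆X))
      where
      ⊆ : ∀ {X Y : Pred A ℓ} → ¬ (∃ λ x → x ∈ X × x ∉ Y) → X ⊆ Y
      ⊆ {Y = Y} none {x} x∈X with em {x ∈ Y}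
      ... | yes x∈Y = x∈Y
      ... | no x∉Y  = contradiction (x , x∈X , x∉Y) none

    length-halves : ∀ (x : A) Xs →
      length (filter (x ∋?_) Xs) + length (filter (∁? (x ∋?_)) Xs) ≡ length Xs
    length-halves x []       = refl
    length-halves x (X ∷ Xs) with x ∋? X
    ... | yes _ = cong suc (length-halves x Xs)
    ... | no _  = trans (+-suc (length (filter (x ∋?_) Xs)) _) (cong suc (length-halves x Xs))

    module _ (x : A) {e : List A} {w : Word} where

      containing : ∀ {n} (c : Class e w n) →
        Class (x ∷ e) (true ∷ w) (length (filter (x ∋?_) (Class.sets c)))
      containing (class Xs distinct members _) = class
        (filter (x ∋?_) Xs) (AllPairs.filter⁺ (x ∋?_) distinct)
        (All.zipWith (λ {X} (x∈X , X∈H , ps) → X∈H , agrees-true X x∈X ∷ ps)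
          (All.all-filter (x ∋?_) Xs , All.filter⁺ (x ∋?_) members))
        refl

      avoiding : ∀ {n} (c : Class e w n) →
        Class (x ∷ e) (false ∷ w) (length (filter (∁? (x ∋?_)) (Class.sets c)))
      avoiding (class Xs distinct members _) = class
        (filter (∁? (x ∋?_)) Xs) (AllPairs.filter⁺ (∁? (x ∋?_)) distinct)
        (All.zipWith (λ {X} (x∉X , X∈H , ps) → X∈H , agrees-false X x∉X ∷ ps)
          (All.all-filter (∁? (x ∋?_)) Xs , All.filter⁺ (∁? (x ∋?_)) members))
        refl

      split : ∀ {n} → Class e w n →
        ∃₂ λ i j → j + i ≡ n × Class (x ∷ e) (true ∷ w) i × Class (x ∷ e) (false ∷ w) j
      split c = _ , _ , trans (+-comm (length (filter (∁? (x ∋?_)) (Class.sets c))) _)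
                              (trans (length-halves x (Class.sets c)) (Class.size c)) ,
                containing c , avoiding c

    extend : ∀ {e w n} (X : Pred A ℓ) → X ∈ H × Traces X e w →
      (c : Class e w n) → All (λ Y → ¬ X ≐ Y) (Class.sets c) → Class e w (suc n)
    extend X X∈H×traces (class Xs distinct members size) X∉Xs =
      class (X ∷ Xs) (X∉Xs ∷ distinct) (X∈H×traces ∷ members) (cong suc size)

    -- The first two sets are put aside, the rest is split by an element separating these two, and
    -- each of the two then joins its own side, which keeps both halves nonempty.
    split-properly : ∀ {e w n} → Class e w (suc (suc n)) → ∃ λ x → ∃₂ λ i j → j + i ≡ n ×
      Class (x ∷ e) (true ∷ w) (suc i) × Class (x ∷ e) (false ∷ w) (suc j)
    split-properly {e} {w} {n}
      (class (X ∷ Y ∷ Xs) ((X≠Y ∷ X∉Xs) ∷ Y∉Xs ∷ distinct) (mX ∷ mY ∷ members) size)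
      with separate {X} {Y} X≠Y
    ... | x , inj₁ (x∈X , x∉Y) =
      let rest = class Xs distinct members (suc-injective (suc-injective size))
          i , j , j+i≡n , c , c′ = split x rest
      in x , i , j , j+i≡n ,
         extend X (proj₁ mX , agrees-true X x∈X ∷ proj₂ mX) c (All.filter⁺ (x ∋?_) X∉Xs) ,
         extend Y (proj₁ mY , agrees-false Y x∉Y ∷ proj₂ mY) c′ (All.filter⁺ (∁? (x ∋?_)) Y∉Xs)
    ... | x , inj₂ (x∈Y , x∉X) =
      let rest = class Xs distinct members (suc-injective (suc-injective size))
          i , j , j+i≡n , c , c′ = split x rest
      in x , i , j , j+i≡n ,
         extend Y (proj₁ mY , agrees-true Y x∈Y ∷ proj₂ mY) c (All.filter⁺ (x ∋?_) Y∉Xs) ,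
         extend X (proj₁ mX , agrees-false X x∉X ∷ proj₂ mX) c′ (All.filter⁺ (∁? (x ∋?_)) X∉Xs)

    split-all-sound : ∀ {x e} p {s ts} k → Realised e p → Realised (x ∷ e) s →
      Tabulated x (pairs e) ts → T (split-all p s ts k) →
      (∀ {s} → Realised (x ∷ e) s → T (k s) → Unavoidable) → Unavoidable
    split-all-sound []            k []       ds ss ok c = c ds ok
    split-all-sound {x} ((w , n) ∷ p) k (d ∷ ps) ds ss ok c
      with split x d
    ... | i , j , refl , d₁ , d₀ =
      -- Matching on `j + i ≡ n` gives `n` the shape that `sums-sound` expects; as the accumulator
      -- starts at 0, the second size comes out as `j + 0`.
      halves-sound i (j + 0) _ d₁ (subst (Class _ _) (sym (+-identityʳ j)) d₀) ds ss
        (sums-sound _ j ok) λ ds ss ok → split-all-sound p k ps ds ss ok c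

    unavoidable?-sound : ∀ f s {e} → Realised e s → unavoidable? f s ≡ true → Unavoidable
    unavoidable?-sound (suc f) ((w , suc (suc n)) ∷ p) (d ∷ ds) ok
      with split-properly d | member d
    ... | x , i , j , refl , d₁ , d₀ | X , X∈H , traces =
      halves-sound (suc i) (suc (j + 0)) _ d₁
        (subst (Class _ _) (cong suc (sym (+-identityʳ j))) d₀) []
        -- The traces of one member show that `e` and `w` have equal length, so that each pair from
        -- `e` gets one empty table.
        (empty-tabulated (pairs⁺ traces)) (sums-sound _ j (from T-≡ ok))
        λ ds′ ss ok → split-all-sound p (unavoidable? f) ds ds′ ss ok
          λ {s} ds′ ok → unavoidable?-sound f s ds′ (to T-≡ ok)

-- Stated with _≡_ rather than T, whose reduction would rerun the search at every
-- use.
nine-unavoidable : unavoidable? 9 (([] , 9) ∷ []) ≡ true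
nine-unavoidable = refl

nine-force : ExcludedMiddle ℓ → Forces ℓ 2 2 8
nine-force em H (X , X-injective , X∈H) =
  unavoidable?-sound H em 9 (([] , 9) ∷ []) (c ∷ []) nine-unavoidable
  where
  c : Class H [] [] 9
  c = class (List.tabulate X)
    (AllPairs.tabulate⁺ λ i≢j Xi≐Xj → i≢j (X-injective Xi≐Xj))
    (All.tabulate⁺ λ i → X∈H i , []) (length-tabulate X)

-- Eight sets that avoid the three matrices

eight : Fin 8 → Fin 4 → Bool
eight i = lookup (lookup rows i)
  where
  rows : Vec (Vec Bool 4) 8
  -- Number the columns from 0. A triple containing both 2 and 3 never shows 000 and misses a word
  -- with two `true` entries; the other two triples never show 111 and miss a word with one. Either
  -- way all three matrices are excluded.
  rows = (false ∷ false ∷ false ∷ true  ∷ [])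
       ∷ (false ∷ false ∷ true  ∷ false ∷ [])
       ∷ (false ∷ false ∷ true  ∷ true  ∷ [])
       ∷ (false ∷ true  ∷ false ∷ true  ∷ [])
       ∷ (false ∷ true  ∷ true  ∷ true  ∷ [])
       ∷ (true  ∷ false ∷ true  ∷ false ∷ [])
       ∷ (true  ∷ false ∷ true  ∷ true  ∷ [])
       ∷ (true  ∷ true  ∷ false ∷ false ∷ [])
       ∷ []

-- Rows and columns may repeat in the excluded pattern, which turns avoidance into a plain finite
-- check.
Avoids : Matrix a b → Matrix n 3 → Set
Avoids {b = b} N M = ∀ (x y z : Fin b) →
  ¬ (∀ i → ∃ λ k → ∀ j → N k (lookup (x ∷ y ∷ z ∷ []) j) ≡ M i j)

avoids? : (N : Matrix a b) (M : Matrix n 3) → Dec (Avoids N M)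
avoids? N M = all? λ x → all? λ y → all? λ z →
  ¬? (all? λ i → any? λ k → all? λ j → N k (lookup (x ∷ y ∷ z ∷ []) j) ≟ᵇ M i j)

module _ (ℓ : Level) (N : Matrix a b) where

  row : Fin a → Pred (Lift ℓ (Fin b)) ℓ
  row i (lift j) = Lift ℓ (N i j ≡ true)

  rows : Collection (Lift ℓ (Fin b))
  rows X = ∃ λ i → X ≐ row i

  rows-avoid : (M : Matrix n 3) → Avoids N M → ¬ FoundIn M rows
  rows-avoid M avoids (X , e , _ , X∈rows , _ , _ , M⇔∈) =
    avoids (lower (e (# 0))) (lower (e (# 1))) (lower (e (# 2))) λ i →
      let k , X⊆k , k⊆X = X∈rows i
          entry : ∀ j → N k (lower (e j)) ≡ M i j
          entry j = ⇔→≡ (mk⇔ (λ p → from (M⇔∈ i j) (k⊆X (lift p)))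
                             (λ p → lower (X⊆k (to (M⇔∈ i j) p))))
      in k , λ { zero → entry (# 0) ; (suc zero) → entry (# 1) ; (suc (suc zero)) → entry (# 2) }

  rows-atLeast : (∀ i i′ → (∀ j → N i j ≡ N i′ j) → i ≡ i′) → n ≤ a → AtLeast n rows
  rows-atLeast distinct n≤a =
    (λ i → row (inject≤ i n≤a)) ,
    (λ (⊆ , ⊇) → inject≤-injective n≤a n≤a _ _ (distinct _ _ λ j →
      ⇔→≡ (mk⇔ (λ p → lower (⊆ {lift j} (lift p))) (λ p → lower (⊇ {lift j} (lift p)))))) ,
    λ i → inject≤ i n≤a , (λ p → p) , (λ p → p)

eight-do-not-force : ∀ t → Forces ℓ 2 2 t → 8 ≤ t
eight-do-not-force {ℓ} t forces = ≮⇒≥ λ t<8 →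
  [ rows-avoid ℓ eight (singleton 3) (from-yes (avoids? eight (singleton 3)))
  , [ rows-avoid ℓ eight (cosingleton 3) (from-yes (avoids? eight (cosingleton 3)))
    , rows-avoid ℓ eight (monotone 3) (from-yes (avoids? eight (monotone 3))) ] ]
  -- By definition `t<8` is `suc t ≤ 8`, so the first `suc t` rows are the distinct sets that
  -- `Forces` asks for.
  (forces (rows ℓ eight) (rows-atLeast ℓ eight (proj₁ (from-yes (reduced? eight))) t<8))

proposition2 : ∀ {ℓ} → ExcludedMiddle ℓ →
    ({A : Set ℓ} (H : Collection A) → AtLeast 9 H →
    FoundIn (singleton 3) H ⊎ FoundIn (cosingleton 3) H ⊎ FoundIn (monotone 3) H)
    × IsS ℓ 2 2 8
proposition2 em = nine-force em , nine-force em , eight-do-not-force
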